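{- Let $c$, $d$ be positive integers, let $k\ge 2$, and let $n_1\leq n_2\leq\dots\leq n_k$ be even positive integers. Then $2k<\chi_{ld}(B_{c,d}[K_{n_1,n_2,\dots,n_k}])\leq 3k$.
   Context: All graphs are finite, simple and undirected. For a graph $G$ of order $n$ and a bijection $f\colon V(G)\to\{1,2,\dots,n\}$, the weight of a vertex $u$ is $w_f(u)=\sum_{x\in N(u)}f(x)$, where $N(u)$ is the open neighborhood of $u$. The bijection $f$ is a local distance antimagic labeling of $G$ if $w_f(u)\neq w_f(v)$ for every edge $uv$ of $G$. The local distance antimagic chromatic number $\chi_{ld}(G)$ is the minimum number of distinct weights over all local distance antimagic labelings of $G$ (an upper bound on $\chi_{ld}$ includes the assertion that such a labeling exists). The double star $B_{c,d}$ is obtained from $K_2$ by joining $c$ pendant edges to one end and $d$ pendant edges to the other end. $K_{n_1,\dots,n_k}$ is the complete multipartite graph with parts of sizes $n_1,\dots,n_k$. The lexicographic product (composition) $G[H]$ has vertex set $V(G)\times V(H)$, with $(g,h)$ and $(g',h')$ adjacent iff either $gg'\in E(G)$, or $g=g'$ and $hh'\in E(H)$. -}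

module Defs where

open import Data.Fin.Base using (Fin; zero; suc; toℕ)
open import Data.Fin.Properties using (+↔⊎; *↔×; inj⇒≟) renaming (_≟_ to _≟ᶠ_)
open import Data.List.Base using (List; map; allFin; filter; length; deduplicate)
open import Data.Nat.Base using (ℕ; zero; suc; _+_; _*_; _≤_)
open import Data.Nat.ListAction using (sum)
open import Data.Nat.Properties using (_≟_)
open import Data.Product.Base using (Σ; ∃-syntax; _×_; _,_; proj₁; proj₂)
open import Data.Product.Function.NonDependent.Propositional using (_×-↔_)
open import Data.Sum.Base using (_⊎_; inj₁; inj₂; [_,_]′)
open import Data.Sum.Function.Propositional using (_⊎-↔_)
open import Data.Vec.Functional using (Vector; foldr)
open import Function.Base using (_∘_)
open import Function.Bundles using (_↔_; _⤖_; mk↔ₛ′; Inverse; Bijection)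
open import Function.Construct.Composition using (_↔-∘_)
open import Function.Construct.Identity using (↔-id)
open import Function.Construct.Symmetry using (↔-sym)
open import Function.Properties.Inverse using (↔⇒↣)
open import Relation.Binary.Construct.Closure.Symmetric using (SymClosure; fwd; bwd; symmetric)
open import Relation.Binary.Core using (Rel)
open import Relation.Binary.Definitions using (Decidable; Symmetric; Irreflexive; DecidableEquality)
open import Relation.Binary.PropositionalEquality using (_≡_; _≢_; refl; sym; ≢-sym)
open import Relation.Nullary.Decidable using (yes; no; ¬?; map′; _×-dec_; _⊎-dec_)
open import Level using (0ℓ)

------------------------------------------------------------------------
-- Finite simple graphs

record Graph : Set₁ where
  field
    Vertex     : Set
    order      : ℕ
    enum       : Vertex ↔ Fin order
    Adj        : Rel Vertex 0ℓ
    adj?       : Decidable Adj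
    adj-sym    : Symmetric Adj
    adj-irrefl : Irreflexive _≡_ Adj

  _≟ⱽ_ : DecidableEquality Vertex
  _≟ⱽ_ = inj⇒≟ (↔⇒↣ enum)

  vertices : List Vertex
  vertices = map (Inverse.from enum) (allFin order)

  neighbours : Vertex → List Vertex
  neighbours u = filter (adj? u) vertices

------------------------------------------------------------------------
-- Local distance antimagic labelings

module _ (G : Graph) where
  open Graph G

  Labeling : Set
  Labeling = Vertex ⤖ Fin order

  -- Fin order is {0,…,order-1}; the labels are {1,…,order}.
  label : Labeling → Vertex → ℕ
  label f v = suc (toℕ (Bijection.to f v))

  weight : Labeling → Vertex → ℕ
  weight f u = sum (map (label f) (neighbours u))

  IsLocalDistanceAntimagic : Labeling → Set
  IsLocalDistanceAntimagic f = ∀ u v → Adj u v → weight f u ≢ weight f v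

  #weights : Labeling → ℕ
  #weights f = length (deduplicate _≟_ (map (weight f) vertices))

  -- χ_ld is partial (a graph need not have such a labeling), so it is
  -- given by its graph: IsChiLD m says that χ_ld(G) is defined and equals m.
  record IsChiLD (m : ℕ) : Set where
    field
      attained : ∃[ f ] (IsLocalDistanceAntimagic f × #weights f ≡ m)
      minimal  : ∀ f → IsLocalDistanceAntimagic f → m ≤ #weights f

------------------------------------------------------------------------
-- Double stars

DSVertex : ℕ → ℕ → Set
DSVertex c d = Fin 2 ⊎ (Fin c ⊎ Fin d)

pattern centreˡ = inj₁ zero
pattern centreʳ = inj₁ (suc zero)
pattern leafˡ i = inj₂ (inj₁ i)
pattern leafʳ i = inj₂ (inj₂ i)

data DSEdge {c d : ℕ} : Rel (DSVertex c d) 0ℓ where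
  middle   :                DSEdge centreˡ centreʳ
  pendantˡ : (i : Fin c) → DSEdge centreˡ (leafˡ i)
  pendantʳ : (i : Fin d) → DSEdge centreʳ (leafʳ i)

dsEdge? : ∀ {c d} → Decidable (DSEdge {c} {d})
dsEdge? centreˡ centreˡ   = no λ ()
dsEdge? centreˡ centreʳ   = yes middle
dsEdge? centreˡ (leafˡ i) = yes (pendantˡ i)
dsEdge? centreˡ (leafʳ i) = no λ ()
dsEdge? centreʳ centreˡ   = no λ ()
dsEdge? centreʳ centreʳ   = no λ ()
dsEdge? centreʳ (leafˡ i) = no λ ()
dsEdge? centreʳ (leafʳ i) = yes (pendantʳ i)
dsEdge? (leafˡ _) _       = no λ ()
dsEdge? (leafʳ _) _       = no λ ()

doubleStar : ℕ → ℕ → Graph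
doubleStar c d = record
  { Vertex     = DSVertex c d
  ; order      = 2 + (c + d)
  ; enum       = ↔-sym +↔⊎ ↔-∘ (↔-id _ ⊎-↔ ↔-sym +↔⊎)
  ; Adj        = SymClosure DSEdge
  ; adj?       = λ u v → map′ [ fwd , bwd ]′ (λ { (fwd e) → inj₁ e ; (bwd e) → inj₂ e })
                              (dsEdge? u v ⊎-dec dsEdge? v u)
  ; adj-sym    = symmetric DSEdge
  ; adj-irrefl = λ { refl (fwd ()) ; refl (bwd ()) }
  }

------------------------------------------------------------------------
-- Complete multipartite graphs

total : ∀ {k} → Vector ℕ k → ℕ
total = foldr _+_ 0

Σ-Fin↔ : ∀ {k} (n : Vector ℕ k) → Σ (Fin k) (Fin ∘ n) ↔ Fin (total n)
Σ-Fin↔ {zero}  n = mk↔ₛ′ (λ ()) (λ ()) (λ ()) (λ ())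
Σ-Fin↔ {suc k} n = ↔-sym +↔⊎ ↔-∘ ((↔-id _ ⊎-↔ Σ-Fin↔ (n ∘ suc)) ↔-∘ uncons)
  where
  uncons : Σ (Fin (suc k)) (Fin ∘ n) ↔ (Fin (n zero) ⊎ Σ (Fin k) (Fin ∘ n ∘ suc))
  uncons = mk↔ₛ′
    (λ { (zero , x) → inj₁ x ; (suc i , x) → inj₂ (i , x) })
    (λ { (inj₁ x) → zero , x ; (inj₂ (i , x)) → suc i , x })
    (λ { (inj₁ x) → refl ; (inj₂ _) → refl })
    (λ { (zero , x) → refl ; (suc i , x) → refl })

completeMultipartite : ∀ {k} → Vector ℕ k → Graph
completeMultipartite {k} n = record
  { Vertex     = Σ (Fin k) (Fin ∘ n)
  ; order      = total n
  ; enum       = Σ-Fin↔ n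
  ; Adj        = λ u v → proj₁ u ≢ proj₁ v
  ; adj?       = λ u v → ¬? (proj₁ u ≟ᶠ proj₁ v)
  ; adj-sym    = ≢-sym
  ; adj-irrefl = λ { refl i≢i → i≢i refl }
  }

------------------------------------------------------------------------
-- Lexicographic product

infix 8 _⟦_⟧

_⟦_⟧ : Graph → Graph → Graph
G ⟦ H ⟧ = record
  { Vertex     = G.Vertex × H.Vertex
  ; order      = G.order * H.order
  ; enum       = ↔-sym *↔× ↔-∘ (G.enum ×-↔ H.enum)
  ; Adj        = λ (g , h) (g′ , h′) → G.Adj g g′ ⊎ (g ≡ g′ × H.Adj h h′)
  ; adj?       = λ (g , h) (g′ , h′) → G.adj? g g′ ⊎-dec (g G.≟ⱽ g′ ×-dec H.adj? h h′)
  ; adj-sym    = λ { (inj₁ a) → inj₁ (G.adj-sym a)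
                   ; (inj₂ (p , a)) → inj₂ (sym p , H.adj-sym a) }
  ; adj-irrefl = λ { refl (inj₁ a) → G.adj-irrefl refl a
                   ; refl (inj₂ (_ , a)) → H.adj-irrefl refl a }
  }
  where
  module G = Graph G
  module H = Graph H

{-# OPTIONS --safe #-}

-- All vertices of one part of one copy of H = K_{n₁,…,n_k} share a neighbourhood, so the weight at part i of
-- the copy at g is T g + S g − P g i, with P g i the label sum of that part, S g that of the copy, and T g the
-- sum of S over the neighbours of g.
--
-- Lower bound: each centre has k weights, and the two sets are disjoint. Let l, r be leaves at the centres u, v
-- with S l ≤ S r. The weights at l are at most S u + S l, those at v exceed S u + S r, and those at u differ
-- from those at l by adjacency; so l has a weight found at neither centre.
--
-- Upper bound: since the parts are even, label them by pairs (low, high) of almost constant sum, so that all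
-- S g agree, the leaves agree on every P g i, and P increases strictly with i whatever the copy. If the two
-- centres have distinct degrees this is enough. For equal degrees the pairs at the centres are twisted so that
-- P differs there by nonzero amounts whose sum over i vanishes.
--
-- The minimum defining χ_ld is found by exhaustive search.
module Submission where

open import Defs
open import Data.Bool.Base using (true; false; if_then_else_)
open import Data.Fin.Base using () renaming (_≤_ to _≤ᶠ_)
open import Data.Fin.Base as Fin using (Fin; zero; suc; toℕ; finToFun; funToFin; _↑ˡ_; _↑ʳ_; combine; punchIn)
import Data.Fin.Permutation as Perm
open import Data.Fin.Properties using
  ( <-cmp; toℕ<n; toℕ-cast; toℕ-combine; toℕ-↑ˡ; toℕ-↑ʳ; opposite-prop; combine-monoˡ-<; any?; all?
  ; finToFun-funToFin; injective⇒≤; *↔×; punchInᵢ≢i; remQuot-combine) renaming (_≟_ to _≟ᶠ_)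
open import Data.List.Base as List using
  (List; []; _∷_; _++_; tabulate; allFin; filter; length; deduplicate; lookup)
open import Data.List.Membership.Propositional using (_∈_)
open import Data.List.Membership.Propositional.Properties using
  ( ∈-lookup; ∈-map⁺; ∈-map⁻; ∈-allFin; ∈-deduplicate⁺; ∈-deduplicate⁻; ∈-tabulate⁺; ∈-tabulate⁻
  ; ∈-++⁺ˡ; ∈-++⁺ʳ; ∈-++⁻)
open import Data.List.Properties using (map-∘; map-cong; map-tabulate; length-++; length-tabulate)
import Data.List.Relation.Unary.All as All
open import Data.List.Relation.Unary.AllPairs using (_∷_)
open import Data.List.Relation.Unary.Any using (index; here; there)
open import Data.List.Relation.Unary.Any.Properties using (lookup-index)
open import Data.List.Relation.Unary.Unique.DecPropositional.Properties using (deduplicate-!)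
open import Data.List.Relation.Unary.Unique.Propositional using (Unique)
import Data.List.Relation.Unary.Unique.Propositional.Properties as Unique
open import Data.Nat.Base using (ℕ; zero; suc; _+_; _*_; _∸_; _≤_; _<_; z≤n; s≤s)
open import Data.Nat.Divisibility using (_∣_; quotient)
import Data.Nat.ListAction as ListAction
import Data.Nat.Properties as ℕ
open import Data.Nat.Properties hiding (<-cmp)
open import Data.Nat.Solver using (module +-*-Solver)
open import Data.Product.Base using (Σ; ∃; ∃-syntax; _×_; _,_; proj₁; proj₂)
open import Data.Product.Function.NonDependent.Propositional using (_×-↔_)
open import Data.Sum.Base as Sum using (_⊎_; inj₁; inj₂)
open import Data.Vec.Functional using (Vector; removeAt)
open import Function.Base using (_∘_; id)
open import Function.Bundles using (_↔_; mk⤖; mk↔ₛ′; Bijection; Inverse)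
open import Function.Construct.Composition using (_↔-∘_)
open import Function.Construct.Identity using (↔-id)
open import Function.Construct.Symmetry using (↔-sym)
open import Function.Definitions using (Injective; StrictlySurjective)
open import Function.Properties.Inverse using (↔⇒⤖)
open import Relation.Binary.Construct.Closure.Symmetric using (fwd; bwd)
open import Relation.Binary.Definitions using (tri<; tri≈; tri>)
open import Relation.Binary.PropositionalEquality
open import Relation.Nullary using (¬_; Dec; yes; no; does; contradiction)
open import Relation.Nullary.Decidable using (map′; _×-dec_; _→-dec_; _⊎-dec_; ¬?; dec-true; dec-false)
open import Relation.Unary using (Decidable)

open import Algebra.Properties.CommutativeMonoid.Sum +-0-commutativeMonoid using
  (sum; sum-cong-≗; ∑-distrib-+; sum-remove; sum-permute)
open Inverse using (to; from; strictlyInverseˡ; strictlyInverseʳ)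

-- Labelings and the number of weights

lookup-injective : ∀ {A : Set} {xs : List A} → Unique xs → Injective _≡_ _≡_ (lookup xs)
lookup-injective {xs = _ ∷ _} _         {zero}  {zero}  _  = refl
lookup-injective {xs = _ ∷ _} (x∉ ∷ _)  {zero}  {suc j} eq = contradiction eq (All.lookup x∉ (∈-lookup j))
lookup-injective {xs = _ ∷ _} (x∉ ∷ _)  {suc i} {zero}  eq = contradiction (sym eq) (All.lookup x∉ (∈-lookup i))
lookup-injective {xs = _ ∷ _} (_ ∷ xs!) {suc i} {suc j} eq = cong suc (lookup-injective xs! eq)

-- Sending each position in `xs` to a position of the same element in `ys` is injective because `xs`
-- has no repetitions. Both bounds on the number of weights rest on this.
length-⊆ : ∀ {A : Set} {xs ys : List A} → Unique xs → (∀ {x} → x ∈ xs → x ∈ ys) → length xs ≤ length ys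
length-⊆ {xs = xs} {ys} xs! xs⊆ys = injective⇒≤ {f = position} position-injective
  where
  position : Fin (length xs) → Fin (length ys)
  position i = index (xs⊆ys (∈-lookup i))

  position-injective : Injective _≡_ _≡_ position
  position-injective {i} {j} eq = lookup-injective xs! (begin
    lookup xs i             ≡⟨ lookup-index (xs⊆ys (∈-lookup i)) ⟩
    lookup ys (position i)  ≡⟨ cong (lookup ys) eq ⟩
    lookup ys (position j)  ≡⟨ lookup-index (xs⊆ys (∈-lookup j)) ⟨
    lookup xs j             ∎)
    where open ≡-Reasoning

module _ (G : Graph) where
  open Graph G

  private
    vertex : Fin order → Vertex
    vertex = from enum

  ∈-vertices : ∀ v → v ∈ vertices
  ∈-vertices v = subst (_∈ vertices) (strictlyInverseʳ enum v) (∈-map⁺ vertex (∈-allFin (to enum v)))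

  all-vertices? : ∀ {P : Vertex → Set} → Decidable P → Dec (∀ v → P v)
  all-vertices? {P} P? = map′
    (λ ∀P v → subst P (strictlyInverseʳ enum v) (∀P (to enum v)))
    (λ ∀P i → ∀P (vertex i))
    (all? (P? ∘ vertex))

  module _ (f : Labeling G) (xs : List ℕ) where

    private
      weights : List ℕ
      weights = List.map (weight G f) vertices

    length≤#weights : Unique xs → (∀ {x} → x ∈ xs → ∃[ v ] x ≡ weight G f v) → length xs ≤ #weights G f
    length≤#weights xs! attained = length-⊆ xs! λ x∈xs → let v , eq = attained x∈xs in
      ∈-deduplicate⁺ _≟_ (subst (_∈ weights) (sym eq) (∈-map⁺ (weight G f) (∈-vertices v)))

    #weights≤length : (∀ v → weight G f v ∈ xs) → #weights G f ≤ length xs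
    #weights≤length covered = length-⊆ (deduplicate-! _≟_ weights) λ x∈ →
      let v , _ , eq = ∈-map⁻ (weight G f) (∈-deduplicate⁻ _≟_ weights x∈) in subst (_∈ xs) (sym eq) (covered v)

  -- A labeling bundles a function with proofs, so labelings are compared by their values; weights
  -- depend on these values alone.
  _≗ᴸ_ : Labeling G → Labeling G → Set
  f ≗ᴸ g = ∀ v → Bijection.to f v ≡ Bijection.to g v

  weight-cong : ∀ f g → f ≗ᴸ g → ∀ v → weight G f v ≡ weight G g v
  weight-cong f g f≗g v = cong ListAction.sum (map-cong (λ x → cong (suc ∘ toℕ) (f≗g x)) (neighbours v))

  #weights-cong : ∀ f g → f ≗ᴸ g → #weights G f ≡ #weights G g
  #weights-cong f g f≗g = cong (length ∘ deduplicate _≟_) (map-cong (weight-cong f g f≗g) vertices)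

  antimagic-cong : ∀ f g → f ≗ᴸ g → IsLocalDistanceAntimagic G f → IsLocalDistanceAntimagic G g
  antimagic-cong f g f≗g fld u v uv eq =
    fld u v uv (trans (weight-cong f g f≗g u) (trans eq (sym (weight-cong f g f≗g v))))

  antimagic? : Decidable (IsLocalDistanceAntimagic G)
  antimagic? f = all-vertices? λ u → all-vertices? λ v →
    adj? u v →-dec ¬? (weight G f u ≟ weight G f v)

  labeling : (φ : Fin order → Fin order) →
             (∀ i j → φ i ≡ φ j → i ≡ j) → StrictlySurjective _≡_ φ → Labeling G
  labeling φ inj surj = mk⤖
    ( (λ {u} {v} eq → Bijection.injective b (inj _ _ eq))
    , (λ y → vertex (proj₁ (surj y)) , λ { refl →
        trans (cong φ (strictlyInverseˡ enum _)) (proj₂ (surj y)) }))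
    where b = ↔⇒⤖ enum

  -- Labelings are enumerated, up to pointwise equality, by the codes of the maps Fin order → Fin order.
  any-labeling? : ∀ {P : Labeling G → Set} → Decidable P → (∀ {f g} → f ≗ᴸ g → P f → P g) → Dec (∃ P)
  any-labeling? {P} P? resp = map′ (λ (_ , f , _ , Pf) → f , Pf) encode (any? decode?)
    where
    Decodes : Fin _ → Set
    Decodes code = ∃[ f ] (∀ v → Bijection.to f v ≡ finToFun code (to enum v)) × P f

    encode : ∃ P → ∃ Decodes
    encode (f , Pf) = funToFin (Bijection.to f ∘ vertex) , f , (λ v → sym (begin
      finToFun (funToFin (Bijection.to f ∘ vertex)) (to enum v)  ≡⟨ finToFun-funToFin (Bijection.to f ∘ vertex) (to enum v) ⟩
      Bijection.to f (vertex (to enum v))                        ≡⟨ cong (Bijection.to f) (strictlyInverseʳ enum v) ⟩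
      Bijection.to f v                                           ∎)) , Pf
      where open ≡-Reasoning

    decode? : Decidable Decodes
    decode? code with all? (λ i → all? λ j → (finToFun code i ≟ᶠ finToFun code j) →-dec (i ≟ᶠ j))
                    | all? (λ y → any? λ x → finToFun code x ≟ᶠ y)
    ... | yes inj | yes surj = map′
      (λ Pf → labeling (finToFun code) inj surj , (λ _ → refl) , Pf)
      -- `f` and the labeling rebuilt from the code agree in values but carry their own proofs, so
      -- `resp` transports `P`.
      (λ (f , eq , Pf) → resp eq Pf)
      (P? (labeling (finToFun code) inj surj))
    ... | no ¬inj | _ = no λ (f , eq , _) → ¬inj λ i j φi≡φj →
      let f-inj : vertex i ≡ vertex j
          f-inj = Bijection.injective f (trans (at f eq i) (trans φi≡φj (sym (at f eq j))))
      in trans (sym (strictlyInverseˡ enum i)) (trans (cong (to enum) f-inj) (strictlyInverseˡ enum j))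
      where
      at : ∀ f → (∀ v → Bijection.to f v ≡ finToFun code (to enum v)) → ∀ i → Bijection.to f (vertex i) ≡ finToFun code i
      at f eq i = trans (eq (vertex i)) (cong (finToFun code) (strictlyInverseˡ enum i))
    ... | yes _ | no ¬surj = no λ (f , eq , _) → ¬surj λ y →
      let v , fv≡y = Bijection.strictlySurjective f y in to enum v , trans (sym (eq v)) fv≡y

-- Existence of the minimum

least : ∀ {P : ℕ → Set} → Decidable P → ∀ {m} → P m → ∃[ l ] P l × (∀ {j} → P j → l ≤ j) × l ≤ m
least P? {zero}  p = 0 , p , (λ _ → z≤n) , z≤n
least {P} P? {suc m} p with P? 0
... | yes p₀ = 0 , p₀ , (λ _ → z≤n) , z≤n
... | no ¬p₀ = let l , pl , minimal , l≤m = least (P? ∘ suc) p in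
  suc l , pl , (λ { {zero} p₀ → contradiction p₀ ¬p₀ ; {suc j} pj → s≤s (minimal pj) }) , s≤s l≤m

-- Whether a number of weights is attained is decidable, and the number attained by `f` bounds the
-- search for the least one.
antimagic⇒χ : ∀ (G : Graph) f → IsLocalDistanceAntimagic G f →
              ∃[ m ] IsChiLD G m × m ≤ #weights G f
antimagic⇒χ G f fld =
  let m , attained , minimal , m≤ = least attained? (f , fld , refl) in
  m , record { attained = attained ; minimal = λ g gld → minimal (g , gld , refl) } , m≤
  where
  attained? : Decidable (λ m → ∃[ f ] (IsLocalDistanceAntimagic G f × #weights G f ≡ m))
  attained? m = any-labeling? G (λ f → antimagic? G f ×-dec (#weights G f ≟ m))
    (λ {f} {g} f≗g (fld , eq) → antimagic-cong G f g f≗g fld , trans (sym (#weights-cong G f g f≗g)) eq)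

-- Finite sums

sum-mono-≤ : ∀ {n} {f g : Vector ℕ n} → (∀ i → f i ≤ g i) → sum f ≤ sum g
sum-mono-≤ {zero}  f≤g = z≤n
sum-mono-≤ {suc n} f≤g = +-mono-≤ (f≤g zero) (sum-mono-≤ (f≤g ∘ suc))

sum-const : ∀ n x → sum {n} (λ _ → x) ≡ n * x
sum-const zero    x = refl
sum-const (suc n) x = cong (x +_) (sum-const n x)

sum-0 : ∀ {n} {f : Vector ℕ n} → (∀ i → f i ≡ 0) → sum f ≡ 0
sum-0 {n} f≡0 = trans (sum-cong-≗ f≡0) (trans (sum-const n 0) (*-zeroʳ n))

sum-single : ∀ {n} (f : Vector ℕ n) i → (∀ j → i ≢ j → f j ≡ 0) → sum f ≡ f i
sum-single {suc n} f i f≡0 = begin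
  sum f                       ≡⟨ sum-remove f ⟩
  f i + sum (removeAt f i)    ≡⟨ cong (f i +_) (sum-0 (λ j → f≡0 (punchIn i j) (≢-sym (punchInᵢ≢i i j)))) ⟩
  f i + 0                     ≡⟨ +-identityʳ (f i) ⟩
  f i                         ∎
  where open ≡-Reasoning

-- All pairs of indices are comparable, so the first `m` terms of `g` dominate those of `f` one by
-- one and the remaining terms only help. It serves to compare parts of different sizes.
sum-mono-dominated-≤ : ∀ {m n} {f : Vector ℕ m} {g : Vector ℕ n} → m ≤ n → (∀ i j → f i ≤ g j) → sum f ≤ sum g
sum-mono-dominated-≤ z≤n       f≤g = z≤n
sum-mono-dominated-≤ (s≤s m≤n) f≤g = +-mono-≤ (f≤g zero zero) (sum-mono-dominated-≤ m≤n (λ i j → f≤g (suc i) (suc j)))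

sum-mono-dominated-< : ∀ {m n} {f : Vector ℕ m} {g : Vector ℕ n} → 0 < m → m ≤ n → (∀ i j → f i < g j) → sum f < sum g
sum-mono-dominated-< (s≤s _) (s≤s m≤n) f<g =
  +-mono-<-≤ (f<g zero zero) (sum-mono-dominated-≤ m≤n (λ i j → <⇒≤ (f<g (suc i) (suc j))))

sum-↑ : ∀ m {n} (f : Vector ℕ (m + n)) → sum f ≡ sum (f ∘ (_↑ˡ n)) + sum (f ∘ (m ↑ʳ_))
sum-↑ zero    f = refl
sum-↑ (suc m) f = trans (cong (f zero +_) (sum-↑ m (f ∘ suc))) (sym (+-assoc (f zero) _ _))

sum-combine : ∀ m {n} (f : Vector ℕ (m * n)) → sum f ≡ sum (λ (i : Fin m) → sum (λ (j : Fin n) → f (combine i j)))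
sum-combine zero        f = refl
sum-combine (suc m) {n} f = trans (sum-↑ n f) (cong (sum (f ∘ (_↑ˡ m * n)) +_) (sum-combine m (f ∘ (n ↑ʳ_))))

when : ∀ {P : Set} → Dec P → ℕ → ℕ
when P? x = if does P? then x else 0

when-true : ∀ {P : Set} (P? : Dec P) → P → ∀ x → when P? x ≡ x
when-true P? p x = cong (if_then x else 0) (dec-true P? p)

when-false : ∀ {P : Set} (P? : Dec P) → ¬ P → ∀ x → when P? x ≡ 0
when-false P? ¬p x = cong (if_then x else 0) (dec-false P? ¬p)

when≤ : ∀ {P : Set} (P? : Dec P) x → when P? x ≤ x
when≤ (yes _) x = ≤-refl
when≤ (no _)  x = z≤n

when-⊎ : ∀ {P Q : Set} (P? : Dec P) (Q? : Dec Q) → ¬ (P × Q) → ∀ x → when (P? ⊎-dec Q?) x ≡ when P? x + when Q? x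
when-⊎ (no _)  Q?      disjoint x = refl
when-⊎ (yes p) (no _)  disjoint x = sym (+-identityʳ x)
when-⊎ (yes p) (yes q) disjoint x = contradiction (p , q) disjoint

when-× : ∀ {P Q : Set} (P? : Dec P) (Q? : Dec Q) x → when (P? ×-dec Q?) x ≡ when P? (when Q? x)
when-× (no _)  Q? x = refl
when-× (yes p) Q? x = refl

when-¬ : ∀ {P : Set} (P? : Dec P) x → when (¬? P?) x + when P? x ≡ x
when-¬ (no _)  x = +-identityʳ x
when-¬ (yes p) x = refl

-- At most one summand on the left is nonzero. `P` and `Q` will say that a vertex is one of two
-- distinct neighbours, `R` that it is adjacent.
when-+-≤ : ∀ {P Q R : Set} (P? : Dec P) (Q? : Dec Q) (R? : Dec R) →
           (P → R) → (Q → R) → ¬ (P × Q) → ∀ x → when P? x + when Q? x ≤ when R? x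
when-+-≤ (yes p) (yes q) R? p⇒r q⇒r disjoint x = contradiction (p , q) disjoint
when-+-≤ (yes p) (no _)  R? p⇒r q⇒r disjoint x =
  ≤-reflexive (trans (+-identityʳ x) (sym (when-true R? (p⇒r p) x)))
when-+-≤ (no _)  (yes q) R? p⇒r q⇒r disjoint x = ≤-reflexive (sym (when-true R? (q⇒r q) x))
when-+-≤ (no _)  (no _)  R? p⇒r q⇒r disjoint x = z≤n

sum-when : ∀ {P : Set} (P? : Dec P) n (f : Vector ℕ n) → sum (λ i → when P? (f i)) ≡ when P? (sum f)
sum-when (yes _) n f = refl
sum-when (no _)  n f = sum-0 {n} (λ _ → refl)

sumᴸ-filter : ∀ {A : Set} {P : A → Set} (P? : Decidable P) (f : A → ℕ) xs →
              ListAction.sum (List.map f (filter P? xs)) ≡ ListAction.sum (List.map (λ x → when (P? x) (f x)) xs)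
sumᴸ-filter P? f []       = refl
sumᴸ-filter P? f (x ∷ xs) with does (P? x)
... | true  = cong (f x +_) (sumᴸ-filter P? f xs)
... | false = sumᴸ-filter P? f xs

sumᴸ-tabulate : ∀ {n} (f : Fin n → ℕ) → ListAction.sum (List.tabulate f) ≡ sum f
sumᴸ-tabulate {zero}  f = refl
sumᴸ-tabulate {suc n} f = cong (f zero +_) (sumᴸ-tabulate (f ∘ suc))

-- Sums over vertices and neighbourhoods

module _ (G : Graph) where
  open Graph G

  ∑ : (Vertex → ℕ) → ℕ
  ∑ φ = sum (φ ∘ from enum)

  ∑-mono : ∀ {φ ψ} → (∀ v → φ v ≤ ψ v) → ∑ φ ≤ ∑ ψ
  ∑-mono φ≤ψ = sum-mono-≤ (φ≤ψ ∘ from enum)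

  ∑-cong : ∀ {φ ψ} → (∀ v → φ v ≡ ψ v) → ∑ φ ≡ ∑ ψ
  ∑-cong φ≡ψ = sum-cong-≗ (φ≡ψ ∘ from enum)

  ∑-+ : ∀ φ ψ → ∑ (λ v → φ v + ψ v) ≡ ∑ φ + ∑ ψ
  ∑-+ φ ψ = ∑-distrib-+ (φ ∘ from enum) (ψ ∘ from enum)

  ∑-single : ∀ (φ : Vertex → ℕ) v → (∀ w → v ≢ w → φ w ≡ 0) → ∑ φ ≡ φ v
  ∑-single φ v φ≡0 = trans
    (sum-single (φ ∘ from enum) (to enum v) λ j v≢j →
      φ≡0 _ λ v≡j → v≢j (trans (cong (to enum) v≡j) (strictlyInverseˡ enum j)))
    (cong φ (strictlyInverseʳ enum v))

  ∑-at : ∀ (φ : Vertex → ℕ) v → ∑ (λ w → when (v ≟ⱽ w) (φ w)) ≡ φ v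
  ∑-at φ v = trans
    (∑-single (λ w → when (v ≟ⱽ w) (φ w)) v (λ w v≢w → when-false (v ≟ⱽ w) v≢w (φ w)))
    (when-true (v ≟ⱽ v) refl (φ v))

  ∑-≥ : ∀ (φ : Vertex → ℕ) v → φ v ≤ ∑ φ
  ∑-≥ φ v = begin
    φ v                                ≡⟨ ∑-at φ v ⟨
    ∑ (λ w → when (v ≟ⱽ w) (φ w))      ≤⟨ ∑-mono (λ w → when≤ (v ≟ⱽ w) (φ w)) ⟩
    ∑ φ                                ∎
    where open ≤-Reasoning

  ∑-adj : (Vertex → ℕ) → Vertex → ℕ
  ∑-adj φ v = ∑ (λ w → when (adj? v w) (φ w))

  ∑-adj-≤ : ∀ φ v → ∑-adj φ v ≤ ∑ φ
  ∑-adj-≤ φ v = ∑-mono (λ w → when≤ (adj? v w) (φ w))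

  ∑-adj-≥ : ∀ φ {v w} → Adj v w → φ w ≤ ∑-adj φ v
  ∑-adj-≥ φ {v} {w} vw = ≤-trans (≤-reflexive (sym (when-true (adj? v w) vw (φ w)))) (∑-≥ _ w)

  ∑-adj-≥₂ : ∀ φ {v w x} → Adj v w → Adj v x → w ≢ x → φ w + φ x ≤ ∑-adj φ v
  ∑-adj-≥₂ φ {v} {w} {x} vw vx w≢x = begin
    φ w + φ x  ≡⟨ cong₂ _+_ (∑-at φ w) (∑-at φ x) ⟨
    ∑ (λ y → when (w ≟ⱽ y) (φ y)) + ∑ (λ y → when (x ≟ⱽ y) (φ y))
               ≡⟨ ∑-+ (λ y → when (w ≟ⱽ y) (φ y)) (λ y → when (x ≟ⱽ y) (φ y)) ⟨
    ∑ (λ y → when (w ≟ⱽ y) (φ y) + when (x ≟ⱽ y) (φ y))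
               ≤⟨ ∑-mono termwise ⟩
    ∑-adj φ v  ∎
    where
    open ≤-Reasoning
    termwise : ∀ y → when (w ≟ⱽ y) (φ y) + when (x ≟ⱽ y) (φ y) ≤ when (adj? v y) (φ y)
    termwise y = when-+-≤ (w ≟ⱽ y) (x ≟ⱽ y) (adj? v y)
      (λ { refl → vw }) (λ { refl → vx }) (λ (w≡y , x≡y) → w≢x (trans w≡y (sym x≡y))) (φ y)

  ∑-adj-single : ∀ φ {v w} → Adj v w → (∀ x → Adj v x → w ≡ x) → ∑-adj φ v ≡ φ w
  ∑-adj-single φ {v} {w} vw only = trans
    (∑-single _ w (λ x w≢x → when-false (adj? v x) (w≢x ∘ only x) (φ x)))
    (when-true (adj? v w) vw (φ w))

  -- Replaces the filtered list by an indicator sum over all vertices, which can be split along a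
  -- product.
  weight≡∑-adj : ∀ f v → weight G f v ≡ ∑-adj (label G f) v
  weight≡∑-adj f v = begin
    ListAction.sum (List.map (label G f) (neighbours v))        ≡⟨ sumᴸ-filter (adj? v) (label G f) vertices ⟩
    ListAction.sum (List.map φ (List.map (from enum) (allFin order)))
      ≡⟨ cong ListAction.sum (map-∘ (allFin order)) ⟨
    ListAction.sum (List.map (φ ∘ from enum) (allFin order))    ≡⟨ cong ListAction.sum (map-tabulate id (φ ∘ from enum)) ⟩
    ListAction.sum (List.tabulate (φ ∘ from enum))              ≡⟨ sumᴸ-tabulate (φ ∘ from enum) ⟩
    ∑ φ                                                         ∎
    where
    open ≡-Reasoning
    φ : Vertex → ℕ
    φ w = when (adj? v w) (label G f w)

-- Sums over products, multipartite graphs and double stars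

module _ (G H : Graph) where
  private
    module G = Graph G
    module H = Graph H

  ∑-⟦⟧ : ∀ φ → ∑ (G ⟦ H ⟧) φ ≡ ∑ G (λ g → ∑ H (λ h → φ (g , h)))
  ∑-⟦⟧ φ = trans (sum-combine G.order _) (sum-cong-≗ λ i → sum-cong-≗ λ j →
    cong (λ (i , j) → φ (from G.enum i , from H.enum j)) (remQuot-combine i j))

  -- Copies over neighbours of `g` contribute their whole sums; in the copy at `g` only the
  -- neighbours of `h` count.
  ∑-adj-⟦⟧ : ∀ φ g h → ∑-adj (G ⟦ H ⟧) φ (g , h) ≡
             ∑-adj G (λ g′ → ∑ H (λ h′ → φ (g′ , h′))) g + ∑-adj H (λ h′ → φ (g , h′)) h
  ∑-adj-⟦⟧ φ g h = begin
    ∑-adj (G ⟦ H ⟧) φ (g , h)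
      ≡⟨ ∑-⟦⟧ (λ (g′ , h′) → when (Graph.adj? (G ⟦ H ⟧) (g , h) (g′ , h′)) (φ (g′ , h′))) ⟩
    ∑ G (λ g′ → ∑ H (λ h′ → when (Graph.adj? (G ⟦ H ⟧) (g , h) (g′ , h′)) (φ (g′ , h′))))
      ≡⟨ ∑-cong G row ⟩
    ∑ G (λ g′ → when (G.adj? g g′) (S g′) + when (g G.≟ⱽ g′) (Q g′))
      ≡⟨ ∑-+ G (λ g′ → when (G.adj? g g′) (S g′)) (λ g′ → when (g G.≟ⱽ g′) (Q g′)) ⟩
    ∑-adj G S g + ∑ G (λ g′ → when (g G.≟ⱽ g′) (Q g′))
      ≡⟨ cong (∑-adj G S g +_) (∑-at G Q g) ⟩
    ∑-adj G S g + Q g  ∎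
    where
    open ≡-Reasoning
    S Q : G.Vertex → ℕ
    S g′ = ∑ H (λ h′ → φ (g′ , h′))
    Q g′ = ∑-adj H (λ h′ → φ (g′ , h′)) h

    row : ∀ g′ → ∑ H (λ h′ → when (Graph.adj? (G ⟦ H ⟧) (g , h) (g′ , h′)) (φ (g′ , h′))) ≡
                 when (G.adj? g g′) (S g′) + when (g G.≟ⱽ g′) (Q g′)
    row g′ = begin
      ∑ H (λ h′ → when (G.adj? g g′ ⊎-dec (g G.≟ⱽ g′ ×-dec H.adj? h h′)) (φ (g′ , h′)))
        ≡⟨ ∑-cong H (λ h′ → trans
             -- The two clauses of product adjacency exclude each other because `G` is irreflexive.
             (when-⊎ (G.adj? g g′) (g G.≟ⱽ g′ ×-dec H.adj? h h′) (λ (gg′ , g≡g′ , _) → G.adj-irrefl g≡g′ gg′) (φ (g′ , h′)))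
             (cong (when (G.adj? g g′) (φ (g′ , h′)) +_) (when-× (g G.≟ⱽ g′) (H.adj? h h′) (φ (g′ , h′))))) ⟩
      ∑ H (λ h′ → when (G.adj? g g′) (φ (g′ , h′)) + when (g G.≟ⱽ g′) (when (H.adj? h h′) (φ (g′ , h′))))
        ≡⟨ ∑-+ H (λ h′ → when (G.adj? g g′) (φ (g′ , h′))) (λ h′ → when (g G.≟ⱽ g′) (when (H.adj? h h′) (φ (g′ , h′)))) ⟩
      ∑ H (λ h′ → when (G.adj? g g′) (φ (g′ , h′))) + ∑ H (λ h′ → when (g G.≟ⱽ g′) (when (H.adj? h h′) (φ (g′ , h′))))
        ≡⟨ cong₂ _+_ (sum-when (G.adj? g g′) H.order _) (sum-when (g G.≟ⱽ g′) H.order _) ⟩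
      when (G.adj? g g′) (S g′) + when (g G.≟ⱽ g′) (Q g′)  ∎

∑-Σ-Fin : ∀ {k} (n : Vector ℕ k) φ → sum (φ ∘ from (Σ-Fin↔ n)) ≡ sum (λ i → sum (λ x → φ (i , x)))
∑-Σ-Fin {zero}  n φ = refl
∑-Σ-Fin {suc k} n φ = trans (sum-↑ (n zero) _) (cong₂ _+_
  (sum-cong-≗ λ x → cong φ (strictlyInverseʳ (Σ-Fin↔ n) (zero , x)))
  (trans
    -- Writing `j` as the image of its own preimage turns the shifted index into
    -- `to (Σ-Fin↔ n) (suc i , x)`, where the inverse law applies.
    (sum-cong-≗ λ j → cong φ (trans
      (cong (from (Σ-Fin↔ n) ∘ (n zero ↑ʳ_)) (sym (strictlyInverseˡ (Σ-Fin↔ (n ∘ suc)) j)))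
      (strictlyInverseʳ (Σ-Fin↔ n) (let i , x = from (Σ-Fin↔ (n ∘ suc)) j in suc i , x))))
    (∑-Σ-Fin (n ∘ suc) (λ (i , x) → φ (suc i , x)))))

∑-doubleStar : ∀ c d φ → ∑ (doubleStar c d) φ ≡
               φ centreˡ + (φ centreʳ + (sum (λ i → φ (leafˡ i)) + sum (λ i → φ (leafʳ i))))
∑-doubleStar c d φ = cong (λ s → φ centreˡ + (φ centreʳ + s)) (trans (sum-↑ c _) (cong₂ _+_
  (sum-cong-≗ λ i → cong φ (strictlyInverseʳ (Graph.enum (doubleStar c d)) (leafˡ i)))
  (sum-cong-≗ λ i → cong φ (strictlyInverseʳ (Graph.enum (doubleStar c d)) (leafʳ i)))))

-- Lower bound

label-positive : ∀ G (f : Labeling G) v → 0 < label G f v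
label-positive G f v = s≤s z≤n

module _ (G : Graph) {k : ℕ} (n : Vector ℕ (2 + k)) (n>0 : ∀ i → 0 < n i) where
  private
    module G = Graph G
    H : Graph
    H = completeMultipartite n
    module H = Graph H

    representative : Fin (2 + k) → H.Vertex
    representative i = i , Fin.fromℕ< (n>0 i)

    other : (i : Fin (2 + k)) → ∃[ j ] i ≢ j
    other zero    = suc zero , λ ()
    other (suc i) = zero , λ ()

  module _ (f : Labeling (G ⟦ H ⟧)) where

    copySum : G.Vertex → ℕ
    copySum g = ∑ H (λ h → label (G ⟦ H ⟧) f (g , h))

    othersSum : G.Vertex → H.Vertex → ℕ
    othersSum g h = ∑-adj H (λ h′ → label (G ⟦ H ⟧) f (g , h′)) h

    weight-⟦⟧ : ∀ g h → weight (G ⟦ H ⟧) f (g , h) ≡ ∑-adj G copySum g + othersSum g h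
    weight-⟦⟧ g h = trans (weight≡∑-adj (G ⟦ H ⟧) f (g , h)) (∑-adj-⟦⟧ G H (label (G ⟦ H ⟧) f) g h)

    -- With at least two parts, another part holds a neighbour with a positive label. This makes the
    -- weight comparisons of both bounds strict.
    othersSum>0 : ∀ g h → 0 < othersSum g h
    othersSum>0 g (i , x) = let j , i≢j = other i in
      ≤-trans (label-positive (G ⟦ H ⟧) f (g , representative j))
              (∑-adj-≥ H (λ h′ → label (G ⟦ H ⟧) f (g , h′)) {i , x} i≢j)

    module _ (fld : IsLocalDistanceAntimagic (G ⟦ H ⟧) f)
             {u v l r : G.Vertex} (u~v : G.Adj u v) (l~u : G.Adj l u) (v~r : G.Adj v r) (u≢r : u ≢ r)
             (only-u : ∀ x → G.Adj l x → u ≡ x) (l≤r : copySum l ≤ copySum r) where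
      private
        w : G.Vertex → Fin (2 + k) → ℕ
        w g i = weight (G ⟦ H ⟧) f (g , representative i)

        w-injective : ∀ g {i j} → w g i ≡ w g j → i ≡ j
        w-injective g {i} {j} eq with i ≟ᶠ j
        ... | yes i≡j = i≡j
        ... | no  i≢j = contradiction eq (fld (g , representative i) (g , representative j) (inj₂ (refl , i≢j)))

        w-adj : ∀ {g g′} → G.Adj g g′ → ∀ i j → w g i ≢ w g′ j
        w-adj {g} {g′} gg′ i j = fld (g , representative i) (g′ , representative j) (inj₁ gg′)

        l<v : ∀ i j → w l i < w v j
        l<v i j = begin-strict
          w l i                                                        ≡⟨ weight-⟦⟧ l (representative i) ⟩
          ∑-adj G copySum l + othersSum l (representative i)
            -- `u` is the only neighbour of `l`, and the neighbours inside the copy at `l` sum to at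
            -- most the whole copy.
            ≤⟨ +-mono-≤ (≤-reflexive (∑-adj-single G copySum l~u only-u)) (∑-adj-≤ H (λ h → label (G ⟦ H ⟧) f (l , h)) (representative i)) ⟩
          copySum u + copySum l                                        ≤⟨ +-monoʳ-≤ (copySum u) l≤r ⟩
          -- `u` and `r` are distinct neighbours of `v`.
          copySum u + copySum r                                        ≤⟨ ∑-adj-≥₂ G copySum (G.adj-sym u~v) v~r u≢r ⟩
          ∑-adj G copySum v                                            <⟨ m<m+n _ (othersSum>0 v (representative j)) ⟩
          ∑-adj G copySum v + othersSum v (representative j)           ≡⟨ weight-⟦⟧ v (representative j) ⟨
          w v j                                                        ∎
          where open ≤-Reasoning

        -- One weight at the leaf `l` on top of the `2 * (2 + k)` weights at the centres: the extra
        -- entry makes the bound strict.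
        ws : List ℕ
        ws = w l zero ∷ tabulate (w u) ++ tabulate (w v)

        centre-weight : ∀ {x} → x ∈ tabulate (w u) ++ tabulate (w v) → (∃[ i ] x ≡ w u i) ⊎ (∃[ i ] x ≡ w v i)
        centre-weight = Sum.map (∈-tabulate⁻ {f = w u}) (∈-tabulate⁻ {f = w v}) ∘ ∈-++⁻ (tabulate (w u))

        fresh : ∀ {x} → x ∈ tabulate (w u) ++ tabulate (w v) → w l zero ≢ x
        fresh x∈ with centre-weight x∈
        ... | inj₁ (i , refl) = w-adj l~u zero i
        ... | inj₂ (i , refl) = <⇒≢ (l<v zero i)

        disjoint : ∀ {x} → ¬ (x ∈ tabulate (w u) × x ∈ tabulate (w v))
        disjoint (x∈u , x∈v) with ∈-tabulate⁻ {f = w u} x∈u | ∈-tabulate⁻ {f = w v} x∈v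
        ... | i , x≡uᵢ | j , x≡vⱼ = w-adj u~v i j (trans (sym x≡uᵢ) x≡vⱼ)

        unique : Unique ws
        unique = All.tabulate fresh ∷
          Unique.++⁺ (Unique.tabulate⁺ (w-injective u)) (Unique.tabulate⁺ (w-injective v)) disjoint

        attained : ∀ {x} → x ∈ ws → ∃[ y ] x ≡ weight (G ⟦ H ⟧) f y
        attained (here eq) = (l , representative zero) , eq
        attained (there x∈) with centre-weight x∈
        ... | inj₁ (i , x≡) = (u , representative i) , x≡
        ... | inj₂ (i , x≡) = (v , representative i) , x≡

        length-ws : length ws ≡ suc (2 * (2 + k))
        length-ws = cong suc (begin
          length (tabulate (w u) ++ tabulate (w v))          ≡⟨ length-++ (tabulate (w u)) ⟩
          length (tabulate (w u)) + length (tabulate (w v))  ≡⟨ cong₂ _+_ (length-tabulate (w u)) (length-tabulate (w v)) ⟩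
          (2 + k) + (2 + k)                                  ≡⟨ cong ((2 + k) +_) (+-identityʳ (2 + k)) ⟨
          2 * (2 + k)                                        ∎)
          where open ≡-Reasoning

      2k<#weights-ordered : 2 * (2 + k) < #weights (G ⟦ H ⟧) f
      2k<#weights-ordered = ≤-trans (≤-reflexive (sym length-ws)) (length≤#weights (G ⟦ H ⟧) f ws unique attained)

-- The leaf with the smaller copy sum has to play the role of `l`; the double star is symmetric
-- enough to exchange the sides.
2k<#weights : ∀ c d k (n : Vector ℕ (2 + k)) → (∀ i → 0 < n i) →
              let B = doubleStar (suc c) (suc d) ⟦ completeMultipartite n ⟧ in
              ∀ f → IsLocalDistanceAntimagic B f → 2 * (2 + k) < #weights B f
2k<#weights c d k n n>0 f fld
  with ≤-total (copySum G n n>0 f (leafˡ zero)) (copySum G n n>0 f (leafʳ zero))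
  where G = doubleStar (suc c) (suc d)
... | inj₁ l≤r = 2k<#weights-ordered G n n>0 f fld {centreˡ} {centreʳ} {leafˡ zero} {leafʳ zero}
  (fwd middle) (bwd (pendantˡ zero)) (fwd (pendantʳ zero)) (λ ()) (λ { _ (bwd (pendantˡ _)) → refl }) l≤r
  where G = doubleStar (suc c) (suc d)
... | inj₂ r≤l = 2k<#weights-ordered G n n>0 f fld {centreʳ} {centreˡ} {leafʳ zero} {leafˡ zero}
  (bwd middle) (bwd (pendantʳ zero)) (fwd (pendantˡ zero)) (λ ()) (λ { _ (bwd (pendantʳ _)) → refl }) r≤l
  where G = doubleStar (suc c) (suc d)

-- The pair labeling

Σ-Fin↔-mono : ∀ {k} (q : Vector ℕ k) {i j} → i Fin.< j → ∀ y y′ → to (Σ-Fin↔ q) (i , y) Fin.< to (Σ-Fin↔ q) (j , y′)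
Σ-Fin↔-mono {suc k} q {zero} {suc j} _ y y′ = begin-strict
  toℕ (y ↑ˡ total (q ∘ suc))                            ≡⟨ toℕ-↑ˡ y (total (q ∘ suc)) ⟩
  toℕ y                                                 <⟨ toℕ<n y ⟩
  q zero                                                ≤⟨ m≤m+n (q zero) _ ⟩
  q zero + toℕ (to (Σ-Fin↔ (q ∘ suc)) (j , y′))         ≡⟨ toℕ-↑ʳ (q zero) _ ⟨
  toℕ (q zero ↑ʳ to (Σ-Fin↔ (q ∘ suc)) (j , y′))        ∎
  where open ≤-Reasoning
Σ-Fin↔-mono {suc k} q {suc i} {suc j} (s≤s i<j) y y′ = begin-strict
  toℕ (q zero ↑ʳ to (Σ-Fin↔ (q ∘ suc)) (i , y))         ≡⟨ toℕ-↑ʳ (q zero) _ ⟩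
  q zero + toℕ (to (Σ-Fin↔ (q ∘ suc)) (i , y))          <⟨ +-monoʳ-< (q zero) (Σ-Fin↔-mono (q ∘ suc) i<j y y′) ⟩
  q zero + toℕ (to (Σ-Fin↔ (q ∘ suc)) (j , y′))         ≡⟨ toℕ-↑ʳ (q zero) _ ⟨
  toℕ (q zero ↑ʳ to (Σ-Fin↔ (q ∘ suc)) (j , y′))        ∎
  where open ≤-Reasoning

combine-monoʳ-< : ∀ {m n} (i : Fin m) {j j′ : Fin n} → j Fin.< j′ → combine i j Fin.< combine i j′
combine-monoʳ-< {n = n} i {j} {j′} j<j′ = begin-strict
  toℕ (combine i j)     ≡⟨ toℕ-combine i j ⟩
  n * toℕ i + toℕ j     <⟨ +-monoʳ-< (n * toℕ i) j<j′ ⟩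
  n * toℕ i + toℕ j′    ≡⟨ toℕ-combine i j′ ⟨
  toℕ (combine i j′)    ∎
  where open ≤-Reasoning

opposite-complement : ∀ {n} (i : Fin n) → toℕ (Fin.opposite i) + suc (toℕ i) ≡ n
opposite-complement i = trans (cong (_+ suc (toℕ i)) (opposite-prop i)) (m∸n+n≡m (toℕ<n i))

-- `A` will be the copies, `B` the rows, `C` the columns and `S` the levels low and high: every
-- column and level may arrange the copies into rows in its own way.
twisted : ∀ {A B C S : Set} → (C → S → A ↔ B) → (A × (C × S)) ↔ (S × (C × B))
twisted e = mk↔ₛ′
  (λ (a , (t , s)) → s , (t , to (e t s) a))
  (λ (s , (t , b)) → from (e t s) b , (t , s))
  (λ (s , (t , b)) → cong (λ b → s , (t , b)) (strictlyInverseˡ (e t s) b))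
  (λ (a , (t , s)) → cong (λ a → a , (t , s)) (strictlyInverseʳ (e t s) a))

-- A pair of labels contributes a constant plus the difference of the rows of its low and high member.
-- The kinds prescribe this difference at the centres: ±1, ∓1, ∓2 and 0.
data Kind : Set where
  plus minus wide flat : Kind

-- One twisted column per part suffices; the others keep row difference 0.
columnKind : Kind → ∀ {m} → Fin m → Kind
columnKind κ zero    = κ
columnKind κ (suc _) = flat

-- The differences must be nonzero on every part and cancel over all parts. Parts are paired as +1,
-- -1; an odd number of parts ends with +1, +1, -2.
kindOf : ∀ k → Fin (2 + k) → Kind
kindOf 0             zero             = plus
kindOf 0             (suc _)          = minus
kindOf 1             zero             = plus
kindOf 1             (suc zero)       = plus
kindOf 1             (suc (suc _))    = wide
kindOf (suc (suc k)) zero             = plus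
kindOf (suc (suc k)) (suc zero)       = minus
kindOf (suc (suc k)) (suc (suc i))    = kindOf k i

pattern low  = zero
pattern high = suc zero

module _ {c d : ℕ} where
  private
    DS : Set
    DS = DSVertex (suc c) d

    p : ℕ
    p = Graph.order (doubleStar (suc c) d)

    row : DS ↔ Fin p
    row = Graph.enum (doubleStar (suc c) d)

    -- The centres have rows 0 and 1 and the first left leaf has row 2. Swapping the centres by `σ`
    -- changes their rows by 1; after `τ` has moved the right centre to row 2, the same swap changes
    -- them by 2.
    σ τ : DS → DS
    σ centreˡ  = centreʳ
    σ centreʳ  = centreˡ
    σ (inj₂ l) = inj₂ l
    τ centreˡ           = centreˡ
    τ centreʳ           = leafˡ zero
    τ (leafˡ zero)      = centreʳ
    τ (leafˡ (suc i))   = leafˡ (suc i)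
    τ (leafʳ i)         = leafʳ i

    σ-involutive : ∀ v → σ (σ v) ≡ v
    σ-involutive centreˡ  = refl
    σ-involutive centreʳ  = refl
    σ-involutive (inj₂ l) = refl

    τ-involutive : ∀ v → τ (τ v) ≡ v
    τ-involutive centreˡ           = refl
    τ-involutive centreʳ           = refl
    τ-involutive (leafˡ zero)      = refl
    τ-involutive (leafˡ (suc i))   = refl
    τ-involutive (leafʳ i)         = refl

    σ↔ τ↔ : DS ↔ DS
    σ↔ = mk↔ₛ′ σ σ σ-involutive σ-involutive
    τ↔ = mk↔ₛ′ τ τ τ-involutive τ-involutive

    arrange : Kind → Fin 2 → DS ↔ DS
    arrange plus  low  = σ↔
    arrange plus  high = ↔-id DS
    arrange minus low  = ↔-id DS
    arrange minus high = σ↔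
    arrange wide  low  = τ↔
    arrange wide  high = τ↔ ↔-∘ σ↔
    arrange flat  _    = ↔-id DS

    position : Kind → Fin 2 → DS → Fin p
    position κ s g = to row (to (arrange κ s) g)

  -- The shift by 2 keeps the excess nonnegative.
  excess : Kind → DS → ℕ
  excess plus  centreˡ  = 3
  excess plus  centreʳ  = 1
  excess minus centreˡ  = 1
  excess minus centreʳ  = 3
  excess wide  centreˡ  = 0
  excess wide  centreʳ  = 4
  excess flat  (inj₁ _) = 2
  excess _     (inj₂ _) = 2

  private
    -- Each case holds by computing rows. The high row stands on the left to avoid truncated
    -- subtraction.
    excess-position : ∀ κ g → excess κ g + toℕ (position κ high g) ≡ 2 + toℕ (position κ low g)
    excess-position plus  centreˡ           = refl
    excess-position plus  centreʳ           = refl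
    excess-position plus  (inj₂ l)          = refl
    excess-position minus centreˡ           = refl
    excess-position minus centreʳ           = refl
    excess-position minus (inj₂ l)          = refl
    excess-position wide  centreˡ           = refl
    excess-position wide  centreʳ           = refl
    excess-position wide  (leafˡ zero)      = refl
    excess-position wide  (leafˡ (suc i))   = refl
    excess-position wide  (leafʳ i)         = refl
    excess-position flat  centreˡ           = refl
    excess-position flat  centreʳ           = refl
    excess-position flat  (inj₂ l)          = refl

    -- Reversal turns a high row `r` into `p - 1 - r`, so a low and a high label add up to a
    -- constant plus the difference of their rows.
    placed : Kind → Fin 2 → DS ↔ Fin p
    placed κ low  = row ↔-∘ arrange κ low
    placed κ high = Perm.reverse ↔-∘ (row ↔-∘ arrange κ high)

  -- Every flat column has the neutral excess 2, so only the first one deviates; `0 < m` provides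
  -- it.
  sum-excess-column : ∀ κ g {m} → 0 < m → sum (λ (y : Fin m) → excess (columnKind κ y) g) + 2 ≡ excess κ g + m * 2
  sum-excess-column κ g {suc m} _ = begin
    excess κ g + sum (λ (y : Fin m) → excess flat g) + 2  ≡⟨ cong (λ s → excess κ g + s + 2) (sum-cong-≗ (λ (_ : Fin m) → excess-flat g)) ⟩
    excess κ g + sum (λ (y : Fin m) → 2) + 2              ≡⟨ cong (λ s → excess κ g + s + 2) (sum-const m 2) ⟩
    excess κ g + m * 2 + 2                                ≡⟨ +-assoc (excess κ g) (m * 2) 2 ⟩
    excess κ g + (m * 2 + 2)                              ≡⟨ cong (excess κ g +_) (+-comm (m * 2) 2) ⟩
    excess κ g + suc m * 2                                ∎
    where
    open ≡-Reasoning
    excess-flat : ∀ g → excess flat g ≡ 2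
    excess-flat (inj₁ _) = refl
    excess-flat (inj₂ _) = refl

  excess-leaf : ∀ κ l → excess κ (inj₂ l) ≡ 2
  excess-leaf plus  l = refl
  excess-leaf minus l = refl
  excess-leaf wide  l = refl
  excess-leaf flat  l = refl

  -- The prescribed differences cancel, leaving the shift 2 for each part. In the recursion, 4 is
  -- the contribution 3 + 1 of a `plus` and a `minus`.
  sum-excess : ∀ k g → sum (λ i → excess (kindOf k i) g) ≡ (2 + k) * 2
  sum-excess k (inj₂ l) = trans (sum-cong-≗ (λ i → excess-leaf (kindOf k i) l)) (sum-const (2 + k) 2)
  sum-excess 0             centreˡ = refl
  sum-excess 1             centreˡ = refl
  sum-excess (suc (suc k)) centreˡ = cong (4 +_) (sum-excess k centreˡ)
  sum-excess 0             centreʳ = refl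
  sum-excess 1             centreʳ = refl
  sum-excess (suc (suc k)) centreʳ = cong (4 +_) (sum-excess k centreʳ)

  excess-centres-differ : ∀ k i → excess (kindOf k i) centreˡ ≢ excess (kindOf k i) centreʳ
  excess-centres-differ 0             zero          ()
  excess-centres-differ 0             (suc zero)    ()
  excess-centres-differ 1             zero          ()
  excess-centres-differ 1             (suc zero)    ()
  excess-centres-differ 1             (suc (suc zero)) ()
  excess-centres-differ (suc (suc k)) zero          ()
  excess-centres-differ (suc (suc k)) (suc zero)    ()
  excess-centres-differ (suc (suc k)) (suc (suc i)) eq = excess-centres-differ k i eq

  -- Labels are laid out as (low/high, column, row), lexicographically. Column (i , y) holds the y-th pairs of
  -- part i in all copies; high labels run backwards along a column.
  module _ {k : ℕ} (n q : Vector ℕ (2 + k)) (n≡2q : ∀ i → n i ≡ q i * 2) where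
    private
      B H : Graph
      H = completeMultipartite n
      B = doubleStar (suc c) d ⟦ H ⟧

      pair : ∀ i → Fin (n i) ↔ (Fin (q i) × Fin 2)
      pair i = *↔× ↔-∘ Perm.cast-id (n≡2q i)

      halves : Graph.Vertex H ↔ (Σ (Fin (2 + k)) (Fin ∘ q) × Fin 2)
      halves = mk↔ₛ′
        (λ (i , x) → let y , s = to (pair i) x in (i , y) , s)
        (λ ((i , y) , s) → i , from (pair i) (y , s))
        (λ ((i , y) , s) → cong (λ (y , s) → (i , y) , s) (strictlyInverseˡ (pair i) (y , s)))
        (λ (i , x) → cong (i ,_) (strictlyInverseʳ (pair i) x))

      kind : ∀ i → Fin (q i) → Kind
      kind i = columnKind (kindOf k i)

      numbering : Graph.Vertex B ↔ Fin (2 * (total q * p))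
      numbering =
        ↔-sym *↔× ↔-∘ ((↔-id _ ×-↔ (↔-sym *↔× ↔-∘ (Σ-Fin↔ q ×-↔ ↔-id _))) ↔-∘
        (twisted (λ (i , y) → placed (kind i y)) ↔-∘ (↔-id _ ×-↔ halves)))

      -- Both sides count the vertices of `B`, by two bijections.
      order≡ : 2 * (total q * p) ≡ Graph.order B
      order≡ = Perm.↔⇒≡ (Graph.enum B ↔-∘ ↔-sym numbering)

    pairing : Labeling B
    pairing = ↔⇒⤖ (Perm.cast-id order≡ ↔-∘ numbering)

    private
      code : DS → ∀ i → Fin (q i) → Fin 2 → Fin (2 * (total q * p))
      code g i y s = combine s (combine (to (Σ-Fin↔ q) (i , y)) (to (placed (kind i y) s) g))

      label-pairing : ∀ g i y s → label B pairing (g , (i , from (pair i) (y , s))) ≡ suc (toℕ (code g i y s))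
      label-pairing g i y s = cong suc (trans (toℕ-cast order≡ (to numbering (g , (i , from (pair i) (y , s)))))
        (cong (λ (y , s) → toℕ (code g i y s)) (strictlyInverseˡ (pair i) (y , s))))

    partSum : DS → Fin (2 + k) → ℕ
    partSum g i = sum (λ x → label B pairing (g , (i , x)))

    private
      pairSum : DS → ∀ i → Fin (q i) → ℕ
      pairSum g i y = suc (toℕ (code g i y low)) + suc (toℕ (code g i y high))

      partSum≡ : ∀ g i → partSum g i ≡ sum (pairSum g i)
      partSum≡ g i = begin
        sum L                                                           ≡⟨ sum-permute L (↔-sym (Perm.cast-id (n≡2q i))) ⟩
        sum (L ∘ Fin.cast (sym (n≡2q i)))                               ≡⟨ sum-combine (q i) (L ∘ Fin.cast (sym (n≡2q i))) ⟩
        sum (λ y → L (from (pair i) (y , low)) + (L (from (pair i) (y , high)) + 0))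
          ≡⟨ sum-cong-≗ (λ y → cong₂ _+_ (label-pairing g i y low)
               (trans (+-identityʳ _) (label-pairing g i y high))) ⟩
        sum (pairSum g i)                                               ∎
        where
        open ≡-Reasoning
        L : Fin (n i) → ℕ
        L x = label B pairing (g , (i , x))

      -- The sum of a pair whose members lie in equal rows: `M * 0` and `M * 1` are the offsets of
      -- the levels, `t` that of the column, and the rows with the two successors give `suc p`.
      base : ∀ i → Fin (q i) → ℕ
      base i y = suc (M * 0 + t + (M * 1 + t) + p)
        where M = total q * p ; t = p * toℕ (to (Σ-Fin↔ q) (i , y))

      pairSum≡ : ∀ g i y → pairSum g i y + 2 ≡ base i y + excess (kind i y) g
      -- Adding the high row `r` eliminates the reversed row `o` through `o + suc r ≡ p`.
      pairSum≡ g i y = +-cancelʳ-≡ r (pairSum g i y + 2) (base i y + excess (kind i y) g) (begin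
        pairSum g i y + 2 + r
          ≡⟨ cong₂ (λ a b → suc a + suc b + 2 + r) (codes low) (codes high) ⟩
        suc (M * 0 + (t + toℕ (position κ low g))) + suc (M * 1 + (t + o)) + 2 + r
          ≡⟨ solve 6 (λ a b t l o r → con 1 :+ (a :+ (t :+ l)) :+ (con 1 :+ (b :+ (t :+ o))) :+ con 2 :+ r
                        := con 1 :+ (a :+ t :+ (b :+ t)) :+ (o :+ (con 1 :+ r)) :+ (con 2 :+ l)) refl
             (M * 0) (M * 1) t (toℕ (position κ low g)) o r ⟩
        suc (M * 0 + t + (M * 1 + t)) + (o + suc r) + (2 + toℕ (position κ low g))
          ≡⟨ cong₂ (λ a b → suc (M * 0 + t + (M * 1 + t)) + a + b)
               (opposite-complement (position κ high g)) (sym (excess-position κ g)) ⟩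
        base i y + (excess κ g + r)
          ≡⟨ +-assoc (base i y) (excess κ g) r ⟨
        base i y + excess κ g + r ∎)
        where
        open ≡-Reasoning
        open +-*-Solver
        κ = kind i y
        M = total q * p
        t = p * toℕ (to (Σ-Fin↔ q) (i , y))
        r = toℕ (position κ high g)
        o = toℕ (Fin.opposite (position κ high g))

        codes : ∀ s → toℕ (code g i y s) ≡ M * toℕ s + (t + toℕ (to (placed κ s) g))
        codes s = trans (toℕ-combine s _) (cong (M * toℕ s +_) (toℕ-combine (to (Σ-Fin↔ q) (i , y)) _))

    module _ (q>0 : ∀ i → 0 < q i) where

      partBase : Fin (2 + k) → ℕ
      partBase i = sum (base i)

      partSum-excess : ∀ g i → partSum g i + 2 ≡ partBase i + excess (kindOf k i) g
      -- The added `q i * 2` pays the shift by 2 of each of the `q i` columns.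
      partSum-excess g i = +-cancelʳ-≡ (q i * 2) _ _ (begin
        partSum g i + 2 + q i * 2                        ≡⟨ cong (λ s → s + 2 + q i * 2) (partSum≡ g i) ⟩
        sum (pairSum g i) + 2 + q i * 2                  ≡⟨ solve 3 (λ s a b → s :+ a :+ b := s :+ b :+ a) refl (sum (pairSum g i)) 2 (q i * 2) ⟩
        sum (pairSum g i) + q i * 2 + 2                  ≡⟨ cong (λ s → sum (pairSum g i) + s + 2) (sum-const (q i) 2) ⟨
        sum (pairSum g i) + sum {q i} (λ _ → 2) + 2      ≡⟨ cong (_+ 2) (∑-distrib-+ (pairSum g i) (λ _ → 2)) ⟨
        sum (λ y → pairSum g i y + 2) + 2                ≡⟨ cong (_+ 2) (sum-cong-≗ (pairSum≡ g i)) ⟩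
        sum (λ y → base i y + excess (kind i y) g) + 2   ≡⟨ cong (_+ 2) (∑-distrib-+ (base i) (λ y → excess (kind i y) g)) ⟩
        partBase i + sum (λ y → excess (kind i y) g) + 2 ≡⟨ +-assoc (partBase i) _ 2 ⟩
        partBase i + (sum (λ y → excess (kind i y) g) + 2) ≡⟨ cong (partBase i +_) (sum-excess-column (kindOf k i) g (q>0 i)) ⟩
        partBase i + (excess (kindOf k i) g + q i * 2)   ≡⟨ +-assoc (partBase i) (excess (kindOf k i) g) (q i * 2) ⟨
        partBase i + excess (kindOf k i) g + q i * 2     ∎)
        where
        open ≡-Reasoning
        open +-*-Solver

      partSum-leaf : ∀ l i → partSum (inj₂ l) i ≡ partBase i
      partSum-leaf l i = +-cancelʳ-≡ 2 _ _
        (trans (partSum-excess (inj₂ l) i) (cong (partBase i +_) (excess-leaf (kindOf k i) l)))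

      partSum-centres-differ : ∀ i → partSum centreˡ i ≢ partSum centreʳ i
      partSum-centres-differ i eq = excess-centres-differ k i (+-cancelˡ-≡ (partBase i) _ _
        (trans (sym (partSum-excess centreˡ i)) (trans (cong (_+ 2) eq) (partSum-excess centreʳ i))))

      -- The twists cancel over the parts. Hence neighbouring copies contribute to a weight only
      -- through their number.
      sum-partSum : ∀ g → sum (partSum g) ≡ sum partBase
      sum-partSum g = +-cancelʳ-≡ ((2 + k) * 2) _ _ (begin
        sum (partSum g) + (2 + k) * 2                          ≡⟨ cong (sum (partSum g) +_) (sum-const (2 + k) 2) ⟨
        sum (partSum g) + sum {2 + k} (λ _ → 2)                ≡⟨ ∑-distrib-+ (partSum g) (λ _ → 2) ⟨
        sum (λ i → partSum g i + 2)                            ≡⟨ sum-cong-≗ (partSum-excess g) ⟩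
        sum (λ i → partBase i + excess (kindOf k i) g)         ≡⟨ ∑-distrib-+ partBase (λ i → excess (kindOf k i) g) ⟩
        sum partBase + sum (λ i → excess (kindOf k i) g)       ≡⟨ cong (sum partBase +_) (sum-excess k g) ⟩
        sum partBase + (2 + k) * 2                             ∎)
        where open ≡-Reasoning

      -- On each level a column is a block of consecutive labels, and the blocks of part `i` precede
      -- those of part `j` whatever the copies; part `j` also has at least as many pairs.
      partSum-mono : ∀ g g′ {i j} → i Fin.< j → q i ≤ q j → partSum g i < partSum g′ j
      partSum-mono g g′ {i} {j} i<j qi≤qj = begin-strict
        partSum g i         ≡⟨ partSum≡ g i ⟩
        sum (pairSum g i)   <⟨ sum-mono-dominated-< (q>0 i) qi≤qj (λ y y′ → +-mono-< (s≤s (earlier y y′ low)) (s≤s (earlier y y′ high))) ⟩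
        sum (pairSum g′ j)  ≡⟨ partSum≡ g′ j ⟨
        partSum g′ j        ∎
        where
        open ≤-Reasoning
        earlier : ∀ y y′ s → code g i y s Fin.< code g′ j y′ s
        earlier y y′ s = combine-monoʳ-< s (combine-monoˡ-< _ _ (Σ-Fin↔-mono q i<j y y′))

-- Upper bound

-- The non-neighbours of a vertex form exactly its own part.
∑-adj-multipartite : ∀ {k} (n : Vector ℕ k) φ i x →
                     ∑-adj (completeMultipartite n) φ (i , x) + sum (λ y → φ (i , y)) ≡ ∑ (completeMultipartite n) φ
∑-adj-multipartite {k} n φ i x = begin
  ∑-adj H φ (i , x) + part i
    ≡⟨ cong₂ _+_ (trans (∑-Σ-Fin n _) (sum-cong-≗ λ j → sum-when (¬? (i ≟ᶠ j)) (n j) (λ y → φ (j , y)))) (sym part-at) ⟩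
  sum (λ j → when (¬? (i ≟ᶠ j)) (part j)) + sum (λ j → when (i ≟ᶠ j) (part j))
    ≡⟨ ∑-distrib-+ (λ j → when (¬? (i ≟ᶠ j)) (part j)) (λ j → when (i ≟ᶠ j) (part j)) ⟨
  sum (λ j → when (¬? (i ≟ᶠ j)) (part j) + when (i ≟ᶠ j) (part j))
    ≡⟨ sum-cong-≗ (λ j → when-¬ (i ≟ᶠ j) (part j)) ⟩
  sum part
    ≡⟨ ∑-Σ-Fin n φ ⟨
  ∑ H φ  ∎
  where
  open ≡-Reasoning
  H = completeMultipartite n

  part : Fin k → ℕ
  part j = sum (λ y → φ (j , y))

  part-at : sum (λ j → when (i ≟ᶠ j) (part j)) ≡ part i
  part-at = trans
    (sum-single (λ j → when (i ≟ᶠ j) (part j)) i (λ j i≢j → when-false (i ≟ᶠ j) i≢j (part j)))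
    (when-true (i ≟ᶠ i) refl (part i))

-- The successor accounts for the opposite centre.
degree : ∀ {c d} → DSVertex c d → ℕ
degree {c} {d} centreˡ  = suc c
degree {c} {d} centreʳ  = suc d
degree         (inj₂ _) = 1

∑-adj-doubleStar-const : ∀ c d φ a → (∀ v → φ v ≡ a) → ∀ v → ∑-adj (doubleStar c d) φ v ≡ degree v * a
∑-adj-doubleStar-const c d φ a φ≡a centreˡ = begin
  ∑-adj (doubleStar c d) φ centreˡ
    ≡⟨ ∑-doubleStar c d (λ w → when (Graph.adj? (doubleStar c d) centreˡ w) (φ w)) ⟩
  φ centreʳ + (sum (λ i → φ (leafˡ i)) + sum {d} (λ _ → 0))
    ≡⟨ cong₂ _+_ (φ≡a centreʳ) (cong₂ _+_ (sum-cong-≗ (φ≡a ∘ inj₂ ∘ inj₁)) (sum-0 {d} (λ _ → refl))) ⟩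
  a + (sum {c} (λ _ → a) + 0)
    ≡⟨ cong (a +_) (trans (+-identityʳ _) (sum-const c a)) ⟩
  suc c * a ∎
  where open ≡-Reasoning
∑-adj-doubleStar-const c d φ a φ≡a centreʳ = begin
  ∑-adj (doubleStar c d) φ centreʳ
    ≡⟨ ∑-doubleStar c d (λ w → when (Graph.adj? (doubleStar c d) centreʳ w) (φ w)) ⟩
  φ centreˡ + (sum {c} (λ _ → 0) + sum (λ i → φ (leafʳ i)))
    ≡⟨ cong₂ _+_ (φ≡a centreˡ) (cong₂ _+_ (sum-0 {c} (λ _ → refl)) (sum-cong-≗ (φ≡a ∘ inj₂ ∘ inj₂))) ⟩
  a + sum {d} (λ _ → a)
    ≡⟨ cong (a +_) (sum-const d a) ⟩
  suc d * a ∎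
  where open ≡-Reasoning
∑-adj-doubleStar-const c d φ a φ≡a (leafˡ i) = trans
  (∑-adj-single (doubleStar c d) φ (bwd (pendantˡ i)) λ { _ (bwd (pendantˡ _)) → refl })
  (trans (φ≡a centreˡ) (sym (*-identityˡ a)))
∑-adj-doubleStar-const c d φ a φ≡a (leafʳ i) = trans
  (∑-adj-single (doubleStar c d) φ (bwd (pendantʳ i)) λ { _ (bwd (pendantʳ _)) → refl })
  (trans (φ≡a centreʳ) (sym (*-identityˡ a)))

-- Weights of the pair labeling

module _ (c d : ℕ) {k : ℕ} (n q : Vector ℕ (2 + k)) (n≡2q : ∀ i → n i ≡ q i * 2)
         (q>0 : ∀ i → 0 < q i) (n>0 : ∀ i → 0 < n i) (q-mono : ∀ {i j} → i ≤ᶠ j → q i ≤ q j) where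
  private
    G H B : Graph
    G = doubleStar (suc c) (suc d)
    H = completeMultipartite n
    B = G ⟦ H ⟧

    f : Labeling B
    f = pairing n q n≡2q

    P : Graph.Vertex G → Fin (2 + k) → ℕ
    P = partSum n q n≡2q

    A : ℕ
    A = sum (partBase {c} {suc d} n q n≡2q q>0)

    Q : Graph.Vertex G → Graph.Vertex H → ℕ
    Q = othersSum G n n>0 f

    copySum≡A : ∀ g → copySum G n n>0 f g ≡ A
    copySum≡A g = trans (∑-Σ-Fin n (λ h → label B f (g , h))) (sum-partSum n q n≡2q q>0 g)

    Q+P≡A : ∀ g i x → Q g (i , x) + P g i ≡ A
    Q+P≡A g i x = trans (∑-adj-multipartite n (λ h → label B f (g , h)) i x) (copySum≡A g)

    weight≡ : ∀ g h → weight B f (g , h) ≡ degree g * A + Q g h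
    weight≡ g h = trans (weight-⟦⟧ G n n>0 f g h)
      (cong (_+ Q g h) (∑-adj-doubleStar-const (suc c) (suc d) (copySum G n n>0 f) A copySum≡A g))

    P-distinct : ∀ g g′ {i j} → i ≢ j → P g i ≢ P g′ j
    P-distinct g g′ {i} {j} i≢j with <-cmp i j
    ... | tri< i<j _ _ = <⇒≢ (partSum-mono n q n≡2q q>0 g g′ i<j (q-mono (<⇒≤ i<j)))
    ... | tri≈ _ i≡j _ = contradiction i≡j i≢j
    ... | tri> _ _ j<i = >⇒≢ (partSum-mono n q n≡2q q>0 g′ g j<i (q-mono (<⇒≤ j<i)))

    -- Since `0 < Q` and `Q ≤ A`, weights at degree `e` lie above `e * A` and do not exceed
    -- `suc e * A`.
    weight-<-degree : ∀ g g′ h h′ → degree g < degree g′ → weight B f (g , h) < weight B f (g′ , h′)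
    weight-<-degree g g′ h@(i , x) h′ deg< = begin-strict
      weight B f (g , h)         ≡⟨ weight≡ g h ⟩
      degree g * A + Q g h       ≤⟨ +-monoʳ-≤ (degree g * A) (≤-trans (m≤m+n (Q g h) (P g i)) (≤-reflexive (Q+P≡A g i x))) ⟩
      degree g * A + A           ≡⟨ +-comm (degree g * A) A ⟩
      suc (degree g) * A         ≤⟨ *-monoˡ-≤ A deg< ⟩
      degree g′ * A              <⟨ m<m+n (degree g′ * A) (othersSum>0 G n n>0 f g′ h′) ⟩
      degree g′ * A + Q g′ h′    ≡⟨ weight≡ g′ h′ ⟨
      weight B f (g′ , h′)       ∎
      where open ≤-Reasoning

    -- At equal degrees the weight determines `Q`, and `Q+P≡A` then determines the part sum.
    weight-≢-partSum : ∀ g g′ i j x y → degree g ≡ degree g′ → P g i ≢ P g′ j →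
                       weight B f (g , (i , x)) ≢ weight B f (g′ , (j , y))
    weight-≢-partSum g g′ i j x y deg≡ P≢ eq = P≢ (+-cancelˡ-≡ (Q g (i , x)) _ _ (begin
      Q g (i , x) + P g i      ≡⟨ Q+P≡A g i x ⟩
      A                        ≡⟨ Q+P≡A g′ j y ⟨
      Q g′ (j , y) + P g′ j    ≡⟨ cong (_+ P g′ j) Q≡ ⟨
      Q g (i , x) + P g′ j     ∎))
      where
      open ≡-Reasoning
      Q≡ : Q g (i , x) ≡ Q g′ (j , y)
      Q≡ = +-cancelˡ-≡ (degree g * A) _ _ (begin
        degree g * A + Q g (i , x)        ≡⟨ weight≡ g (i , x) ⟨
        weight B f (g , (i , x))          ≡⟨ eq ⟩
        weight B f (g′ , (j , y))         ≡⟨ weight≡ g′ (j , y) ⟩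
        degree g′ * A + Q g′ (j , y)      ≡⟨ cong (λ e → e * A + Q g′ (j , y)) deg≡ ⟨
        degree g * A + Q g′ (j , y)       ∎)

    P-centres-distinct : ∀ i j → P centreˡ i ≢ P centreʳ j
    P-centres-distinct i j with i ≟ᶠ j
    ... | yes refl = partSum-centres-differ n q n≡2q q>0 i
    ... | no  i≢j  = P-distinct centreˡ centreʳ i≢j

    edge-weights : ∀ {g g′} → DSEdge g g′ → ∀ h h′ → weight B f (g , h) ≢ weight B f (g′ , h′)
    edge-weights middle (i , x) (j , y) with ℕ.<-cmp c d
    ... | tri< c<d _ _ = <⇒≢ (weight-<-degree centreˡ centreʳ (i , x) (j , y) (s≤s (s≤s c<d)))
    -- With equal degrees the part sums must separate the centres: the twist does so on the same
    -- part, monotonicity on different parts.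
    ... | tri≈ _ c≡d _ = weight-≢-partSum centreˡ centreʳ i j x y (cong (2 +_) c≡d) (P-centres-distinct i j)
    ... | tri> _ _ d<c = >⇒≢ (weight-<-degree centreʳ centreˡ (j , y) (i , x) (s≤s (s≤s d<c)))
    -- A leaf has degree 1 and a centre at least 2.
    edge-weights (pendantˡ l) h h′ = >⇒≢ (weight-<-degree (leafˡ l) centreˡ h′ h (s≤s (s≤s z≤n)))
    edge-weights (pendantʳ l) h h′ = >⇒≢ (weight-<-degree (leafʳ l) centreʳ h′ h (s≤s (s≤s z≤n)))

    antimagic : IsLocalDistanceAntimagic B f
    antimagic (g , h)       (g′ , h′)       (inj₁ (fwd e))       = edge-weights e h h′
    antimagic (g , h)       (g′ , h′)       (inj₁ (bwd e))       = ≢-sym (edge-weights e h′ h)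
    antimagic (g , (i , x)) (_  , (j , y)) (inj₂ (refl , i≢j)) =
      weight-≢-partSum g g i j x y refl (P-distinct g g i≢j)

    -- The truncated subtraction is exact, as `Q+P≡A` gives `P g i ≤ A`.
    value : Graph.Vertex G → Fin (2 + k) → ℕ
    value g i = degree g * A + (A ∸ P g i)

    weight≡value : ∀ g i x → weight B f (g , (i , x)) ≡ value g i
    weight≡value g i x = trans (weight≡ g (i , x)) (cong (degree g * A +_) (begin
      Q g (i , x)                   ≡⟨ m+n∸n≡m (Q g (i , x)) (P g i) ⟨
      Q g (i , x) + P g i ∸ P g i   ≡⟨ cong (_∸ P g i) (Q+P≡A g i x) ⟩
      A ∸ P g i                     ∎))
      where open ≡-Reasoning

    -- Leaves share their degree and, the twists vanishing there, their part sums; so one leaf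
    -- represents all in the list of values.
    leaf-value : ∀ l i → value (inj₂ l) i ≡ value (leafˡ zero) i
    leaf-value l i = cong (λ s → 1 * A + (A ∸ s))
      (trans (partSum-leaf n q n≡2q q>0 l i) (sym (partSum-leaf n q n≡2q q>0 (inj₁ zero) i)))

    vˡ vʳ vᵖ values : List ℕ
    vˡ = tabulate (value centreˡ)
    vʳ = tabulate (value centreʳ)
    vᵖ = tabulate (value (leafˡ zero))
    values = vˡ ++ vʳ ++ vᵖ

    value∈ : ∀ g i → value g i ∈ values
    value∈ centreˡ  i = ∈-++⁺ˡ (∈-tabulate⁺ {f = value centreˡ} i)
    value∈ centreʳ  i = ∈-++⁺ʳ vˡ (∈-++⁺ˡ (∈-tabulate⁺ {f = value centreʳ} i))
    value∈ (inj₂ l) i = subst (_∈ values) (sym (leaf-value l i))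
      (∈-++⁺ʳ vˡ (∈-++⁺ʳ vʳ (∈-tabulate⁺ {f = value (leafˡ zero)} i)))

    length-values : length values ≡ 3 * (2 + k)
    length-values = begin
      length (vˡ ++ vʳ ++ vᵖ)                    ≡⟨ length-++ vˡ ⟩
      length vˡ + length (vʳ ++ vᵖ)              ≡⟨ cong (length vˡ +_) (length-++ vʳ) ⟩
      length vˡ + (length vʳ + length vᵖ)
        ≡⟨ cong₂ _+_ (length-tabulate (value centreˡ))
             (cong₂ _+_ (length-tabulate (value centreʳ)) (length-tabulate (value (leafˡ zero)))) ⟩
      (2 + k) + ((2 + k) + (2 + k))              ≡⟨ cong (λ s → (2 + k) + ((2 + k) + s)) (+-identityʳ (2 + k)) ⟨
      3 * (2 + k)                                ∎
      where open ≡-Reasoning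

  antimagic-labeling : ∃[ f ] (IsLocalDistanceAntimagic B f × #weights B f ≤ 3 * (2 + k))
  antimagic-labeling = f , antimagic , ≤-trans
    (#weights≤length B f values (λ (g , (i , x)) → subst (_∈ values) (sym (weight≡value g i x)) (value∈ g i)))
    (≤-reflexive length-values)

theorem6p3 : ∀ (c d : ℕ) → 0 < c → 0 < d →
    ∀ (k : ℕ) → 2 ≤ k →
    ∀ (n : Vector ℕ k) →
    (∀ i j → i ≤ᶠ j → n i ≤ n j) →
    (∀ i → 2 ∣ n i) →
    (∀ i → 0 < n i) →
    ∃[ m ] (IsChiLD (doubleStar c d ⟦ completeMultipartite n ⟧) m × 2 * k < m × m ≤ 3 * k)
theorem6p3 (suc c) (suc d) _ _ (suc (suc k)) (s≤s (s≤s _)) n n-mono even n>0 =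
  let f , antimagic , f≤3k = antimagic-labeling c d n q n≡2q q>0 n>0 q-mono
      m , χ , m≤f = antimagic⇒χ B f antimagic
      g , g-antimagic , g≡m = IsChiLD.attained χ
  -- `g` attains the minimum and is itself antimagic, so the lower bound for all labelings passes to
  -- `m`.
  in m , χ , subst (2 * (2 + k) <_) g≡m (2k<#weights c d k n n>0 g g-antimagic) , ≤-trans m≤f f≤3k
  where
  B : Graph
  B = doubleStar (suc c) (suc d) ⟦ completeMultipartite n ⟧

  q : Vector ℕ (2 + k)
  q i = quotient (even i)

  n≡2q : ∀ i → n i ≡ q i * 2
  n≡2q i = _∣_.equality (even i)

  q>0 : ∀ i → 0 < q i
  q>0 i = *-cancelʳ-< 2 0 (q i) (subst (0 <_) (n≡2q i) (n>0 i))

  q-mono : ∀ {i j} → i ≤ᶠ j → q i ≤ q j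
  q-mono {i} {j} i≤j = *-cancelʳ-≤ (q i) (q j) 2 (subst₂ _≤_ (n≡2q i) (n≡2q j) (n-mono i j i≤j))
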